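{- For every integer $k\ge1$, $N(2k+3,k)=3$ if $3\mid k$ and $N(2k+3,k)=1$ if $3\nmid k$.
   Context: For $n>k\ge1$, $N(n,k)$ is the nullity of the $n\times n$ skew-symmetric Toeplitz matrix $A(n,k)$ whose first $k$ superdiagonals have all entries $1$ and whose remaining superdiagonals have all entries $0$. -}

module Defs where

open import Algebra.Apartness.Bundles using (HeytingField; HeytingCommutativeRing)
open import Algebra.Bundles using (CommutativeRing)
import Algebra.Definitions.RawMonoid as RawMonoidDefinitions
open import Data.Bool.Base using (if_then_else_)
open import Data.Fin.Base using (Fin; toℕ)
open import Data.Nat.Base as ℕ using (ℕ; suc)
open import Data.Nat.Properties using (_<?_; _≤?_)
open import Data.Product.Base using (Σ-syntax; ∃-syntax)
open import Data.Vec.Functional using (Vector)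
open import Level using (Level; _⊔_)
open import Relation.Nullary.Decidable using (⌊_⌋; _×-dec_)

module LinearAlgebra {c ℓ₁ ℓ₂ : Level} (F : HeytingField c ℓ₁ ℓ₂) where

  open HeytingField F using (_#_; heytingCommutativeRing)
  open CommutativeRing (HeytingCommutativeRing.commutativeRing heytingCommutativeRing)
    using (Carrier; _≈_; _+_; _*_; _-_; 0#; 1#; +-rawMonoid)
  open RawMonoidDefinitions +-rawMonoid using (sum; _×_)

  CharacteristicZero : Set ℓ₂
  CharacteristicZero = ∀ m → (suc m × 1#) # 0#

  Matrix : ℕ → ℕ → Set c
  Matrix m n = Fin m → Fin n → Carrier

  _·_ : ∀ {m n} → Matrix m n → Vector Carrier n → Vector Carrier m
  (M · x) i = sum (λ j → M i j * x j)

  InKernel : ∀ {m n} → Matrix m n → Vector Carrier n → Set ℓ₁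
  InKernel M x = ∀ i → (M · x) i ≈ 0#

  linearCombination : ∀ {d n} → Vector Carrier d → (Fin d → Vector Carrier n) → Vector Carrier n
  linearCombination a b j = sum (λ i → a i * b i j)

  record IsKernelBasis {m n d : ℕ} (M : Matrix m n) (b : Fin d → Vector Carrier n) : Set (c ⊔ ℓ₁) where
    field
      inKernel    : ∀ i → InKernel M (b i)
      independent : ∀ (a : Vector Carrier d) → (∀ j → linearCombination a b j ≈ 0#) → ∀ i → a i ≈ 0#
      spanning    : ∀ (x : Vector Carrier n) → InKernel M x →
                    ∃[ a ] (∀ j → linearCombination a b j ≈ x j)

  -- The nullity of M is d: the null space of M has dimension d.
  HasNullity : ∀ {m n} → Matrix m n → ℕ → Set (c ⊔ ℓ₁)
  HasNullity {n = n} M d = Σ[ b ∈ (Fin d → Vector Carrier n) ] IsKernelBasis M b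

  -- Entry (i , j) of the strictly upper triangular matrix that is 1 on the
  -- superdiagonals j = i + 1 , … , j = i + k and 0 elsewhere.
  superdiagonals : ℕ → ℕ → ℕ → Carrier
  superdiagonals k i j = if ⌊ (i <? j) ×-dec (j ≤? i ℕ.+ k) ⌋ then 1# else 0#

  -- A skew-symmetric matrix is U - Uᵀ for its strictly upper triangular part U.
  A : (n k : ℕ) → Matrix n n
  A n k i j = superdiagonals k (toℕ i) (toℕ j) - superdiagonals k (toℕ j) (toℕ i)

{-# OPTIONS --safe #-}

-- Let P m = x₀ + … + x_{m-1} be the prefix sums of x, so that P is constant
-- from 2k+3 on, and put T = P (2k+3). Row i of A(2k+3,k) x = 0 reads
--   P (i+k+1) + P (i∸k) = P (i+1) + P i.
-- The rows i ≤ k+1 express P (k+1), …, P (2k+2) through P 1, …, P k, and in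
-- particular give P (k+1) = P 1. The remaining rows then say exactly that the
-- word P 1, …, P k, read cyclically, has all its sums of three consecutive
-- letters equal to T. Such a word is 3-periodic as well as k-periodic: for 3 ∣ k
-- its first three letters are free, and otherwise it is constant.

module Submission where

open import Defs
open import Algebra.Apartness.Bundles using (HeytingField; HeytingCommutativeRing)
open import Algebra.Bundles using (CommutativeRing)
import Algebra.Definitions.RawMonoid as RawMonoidDefinitions
import Algebra.Properties.CommutativeMonoid.Sum as SumProperties
import Algebra.Properties.Group as GroupProperties
import Algebra.Solver.CommutativeMonoid as CommutativeMonoidSolver
open import Data.Fin.Base using (Fin; toℕ; fromℕ<) renaming (zero to fzero; suc to fsuc)
open import Data.Fin.Properties using (toℕ<n; toℕ-fromℕ<)
open import Data.Nat.Base using (ℕ; zero; suc; _+_; _*_; _∸_; _≤_; _<_; z≤n; s≤s; s≤s⁻¹; >-nonZero)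
open import Data.Nat.Divisibility using (_∣_; divides; ∣m∣n⇒∣m+n; ∣-refl; ∣⇒≤)
import Data.Nat.Properties as ℕₚ
open import Data.Nat.Tactic.RingSolver using (solve-∀)
open import Data.Product.Base using (_×_; _,_; proj₁; proj₂; ∃-syntax)
open import Data.Sum.Base using (inj₁; inj₂)
open import Data.Vec.Functional using (Vector; tail)
open import Level using (Level)
open import Relation.Binary.PropositionalEquality.Core as ≡ using (_≡_)
import Relation.Binary.Reasoning.Setoid as SetoidReasoning
open import Relation.Nullary.Decidable using (yes; no; _×-dec_)
open import Relation.Nullary.Negation using (¬_; contradiction)

module Kernel {c ℓ₁ ℓ₂ : Level} (F : HeytingField c ℓ₁ ℓ₂) where

  open LinearAlgebra F
  open CommutativeRing (HeytingCommutativeRing.commutativeRing (HeytingField.heytingCommutativeRing F))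
    using (Carrier; _≈_; _-_; 0#; 1#; refl; sym; trans; reflexive; setoid;
           +-cong; +-congˡ; +-congʳ; +-comm; +-identityˡ; +-identityʳ; -‿cong;
           *-congʳ; *-congˡ; *-identityˡ; *-identityʳ; zeroˡ; zeroʳ; distribˡ; distribʳ;
           +-group; +-commutativeMonoid; +-rawMonoid)
    renaming (_+_ to infixl 6 _⊞_; _*_ to infixl 7 _⊠_)
  open RawMonoidDefinitions +-rawMonoid using (sum)
  open SumProperties +-commutativeMonoid using (∑-distrib-+; sum-cong-≋; sum-replicate-zero)
  open GroupProperties +-group using (∙-cancelˡ; ∙-cancelʳ; //-rightDividesˡ; //-rightDividesʳ)
  open CommutativeMonoidSolver +-commutativeMonoid using (solve; _⊕_; _⊜_; id)
  open SetoidReasoning setoid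

  Sequence : Set c
  Sequence = ℕ → Carrier

  at : ∀ (P : Sequence) {m n} → m ≡ n → P m ≈ P n
  at P m≡n = reflexive (≡.cong P m≡n)

  -- Prefix sums

  -- Extended to all of ℕ as if `x` were padded with zeros, because the row equations use indices
  -- beyond the length of `x`.
  prefixSum : ∀ {n} → Vector Carrier n → Sequence
  prefixSum         x zero    = 0#
  prefixSum {zero}  x (suc b) = 0#
  prefixSum {suc n} x (suc b) = x fzero ⊞ prefixSum (tail x) b

  prefixSum-step : ∀ {n} (x : Vector Carrier n) (j : Fin n) →
    prefixSum x (suc (toℕ j)) ≈ x j ⊞ prefixSum x (toℕ j)
  prefixSum-step x fzero    = refl
  prefixSum-step x (fsuc j) = begin
    x fzero ⊞ prefixSum (tail x) (suc (toℕ j))         ≈⟨ +-congˡ (prefixSum-step (tail x) j) ⟩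
    x fzero ⊞ (x (fsuc j) ⊞ prefixSum (tail x) (toℕ j)) ≈⟨ solve 3 (λ a b c → a ⊕ (b ⊕ c) ⊜ b ⊕ (a ⊕ c)) refl _ _ _ ⟩
    x (fsuc j) ⊞ (x fzero ⊞ prefixSum (tail x) (toℕ j)) ∎

  prefixSum-saturated : ∀ {n} (x : Vector Carrier n) i → prefixSum x (n + i) ≈ prefixSum x n
  prefixSum-saturated {zero}  x zero    = refl
  prefixSum-saturated {zero}  x (suc i) = refl
  prefixSum-saturated {suc n} x i       = +-congˡ (prefixSum-saturated (tail x) i)

  prefixSum-zero : ∀ {n} (x : Vector Carrier n) → (∀ j → x j ≈ 0#) → ∀ b → prefixSum x b ≈ 0#
  prefixSum-zero         x x≈0 zero    = refl
  prefixSum-zero {zero}  x x≈0 (suc b) = refl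
  prefixSum-zero {suc n} x x≈0 (suc b) =
    trans (+-cong (x≈0 fzero) (prefixSum-zero (tail x) (λ j → x≈0 (fsuc j)) b)) (+-identityˡ 0#)

  difference : ∀ {n} → Sequence → Vector Carrier n
  difference Q j = Q (suc (toℕ j)) - Q (toℕ j)

  -- The sum telescopes. `Q 0` stays as a summand because the induction passes to the shifted
  -- sequence, whose initial value need not vanish.
  prefixSum-difference : ∀ {n} (Q : Sequence) {b} → b ≤ n →
    prefixSum (difference {n} Q) b ⊞ Q 0 ≈ Q b
  prefixSum-difference Q z≤n = +-identityˡ _
  prefixSum-difference Q {suc b} (s≤s b≤n) = begin
    ((Q 1 - Q 0) ⊞ S) ⊞ Q 0 ≈⟨ solve 3 (λ a b c → (a ⊕ b) ⊕ c ⊜ b ⊕ (a ⊕ c)) refl _ _ _ ⟩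
    S ⊞ ((Q 1 - Q 0) ⊞ Q 0) ≈⟨ +-congˡ (//-rightDividesˡ (Q 0) (Q 1)) ⟩
    S ⊞ Q 1                 ≈⟨ prefixSum-difference (λ m → Q (suc m)) b≤n ⟩
    Q (suc b)               ∎
    where S = prefixSum (difference (λ m → Q (suc m))) b

  difference-prefixSum : ∀ {n} (x : Vector Carrier n) j → difference (prefixSum x) j ≈ x j
  difference-prefixSum x j =
    trans (+-congʳ (prefixSum-step x j)) (//-rightDividesʳ (prefixSum x (toℕ j)) (x j))

  -- The rows of A n k in terms of prefix sums

  -- The characteristic function of j < b, with the same recursion as `prefixSum`, so that
  -- `sum-indicator` is a plain induction.
  indicator : ℕ → ℕ → Carrier
  indicator zero    j       = 0#
  indicator (suc b) zero    = 1#
  indicator (suc b) (suc j) = indicator b j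

  indicator-< : ∀ {b j} → j < b → indicator b j ≡ 1#
  indicator-< {suc b} {zero}  _         = ≡.refl
  indicator-< {suc b} {suc j} (s≤s j<b) = indicator-< j<b

  indicator-≥ : ∀ {b j} → b ≤ j → indicator b j ≡ 0#
  indicator-≥ z≤n       = ≡.refl
  indicator-≥ (s≤s b≤j) = indicator-≥ b≤j

  sum-indicator : ∀ {n} (x : Vector Carrier n) b →
    sum (λ j → indicator b (toℕ j) ⊠ x j) ≈ prefixSum x b
  sum-indicator {zero}  x zero    = refl
  sum-indicator {zero}  x (suc b) = refl
  sum-indicator {suc n} x zero    =
    trans (+-cong (zeroˡ _) (sum-indicator (tail x) zero)) (+-identityˡ 0#)
  sum-indicator {suc n} x (suc b) = +-cong (*-identityˡ _) (sum-indicator (tail x) b)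

  superdiagonals-inside : ∀ {k i j} → i < j → j ≤ i + k → superdiagonals k i j ≡ 1#
  superdiagonals-inside {k} {i} {j} i<j j≤i+k with (i ℕₚ.<? j) ×-dec (j ℕₚ.≤? i + k)
  ... | yes _ = ≡.refl
  ... | no ¬p = contradiction (i<j , j≤i+k) ¬p

  superdiagonals-outside : ∀ {k i j} → ¬ (i < j × j ≤ i + k) → superdiagonals k i j ≡ 0#
  superdiagonals-outside {k} {i} {j} ¬p with (i ℕₚ.<? j) ×-dec (j ℕₚ.≤? i + k)
  ... | yes p = contradiction p ¬p
  ... | no _  = ≡.refl

  -- As a condition on j, the interval i < j ≤ i + k is the initial segment up to i + k with the one
  -- up to i removed.
  superdiagonals-row : ∀ k i j →
    superdiagonals k i j ⊞ indicator (suc i) j ≈ indicator (suc i + k) j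
  superdiagonals-row k i j with i ℕₚ.<? j | j ℕₚ.≤? i + k
  ... | yes i<j | yes j≤i+k
    rewrite indicator-≥ i<j | indicator-< (s≤s j≤i+k) = +-identityʳ 1#
  ... | yes i<j | no j≰i+k
    rewrite indicator-≥ i<j | indicator-≥ (ℕₚ.≰⇒> j≰i+k) = +-identityʳ 0#
  ... | no i≮j  | yes j≤i+k
    rewrite indicator-< (s≤s (ℕₚ.≮⇒≥ i≮j)) | indicator-< (s≤s j≤i+k) = +-identityˡ 1#
  ... | no i≮j  | no j≰i+k =
    contradiction (ℕₚ.≤-trans (ℕₚ.≮⇒≥ i≮j) (ℕₚ.m≤m+n i k)) j≰i+k

  -- Solved for j, the condition j < i ≤ j + k is i ∸ k ≤ j < i; truncation is right because for i ≤
  -- k the interval starts at 0.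
  superdiagonals-column : ∀ k i j →
    superdiagonals k j i ⊞ indicator (i ∸ k) j ≈ indicator i j
  superdiagonals-column k i j with j ℕₚ.<? i | i ℕₚ.≤? j + k
  ... | yes j<i | yes i≤j+k
    rewrite indicator-≥ (ℕₚ.m≤n+o⇒m∸n≤o i k (≡.subst (i ≤_) (ℕₚ.+-comm j k) i≤j+k)) | indicator-< j<i = +-identityʳ 1#
  ... | yes j<i | no i≰j+k
    rewrite indicator-< (ℕₚ.m+n≤o⇒m≤o∸n (suc j) (ℕₚ.≰⇒> i≰j+k)) | indicator-< j<i = +-identityˡ 1#
  ... | no j≮i  | yes _
    rewrite indicator-≥ (ℕₚ.≤-trans (ℕₚ.m∸n≤m i k) (ℕₚ.≮⇒≥ j≮i)) | indicator-≥ (ℕₚ.≮⇒≥ j≮i) = +-identityʳ 0#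
  ... | no j≮i  | no _
    rewrite indicator-≥ (ℕₚ.≤-trans (ℕₚ.m∸n≤m i k) (ℕₚ.≮⇒≥ j≮i)) | indicator-≥ (ℕₚ.≮⇒≥ j≮i) = +-identityʳ 0#

  -- A row is a signed combination of four initial segments; the two negative ones are moved to the
  -- side of the entry.
  A-entry : ∀ {n} k (i j : Fin n) →
    A n k i j ⊞ (indicator (suc (toℕ i)) (toℕ j) ⊞ indicator (toℕ i) (toℕ j)) ≈
    indicator (suc (toℕ i) + k) (toℕ j) ⊞ indicator (toℕ i ∸ k) (toℕ j)
  A-entry k i′ j′ = begin
    (s - t) ⊞ (indicator (suc i) j ⊞ indicator i j)
      ≈⟨ +-congˡ (+-congˡ (superdiagonals-column k i j)) ⟨
    (s - t) ⊞ (indicator (suc i) j ⊞ (t ⊞ indicator (i ∸ k) j))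
      ≈⟨ solve 4 (λ a b c d → a ⊕ (b ⊕ (c ⊕ d)) ⊜ ((a ⊕ c) ⊕ b) ⊕ d) refl _ _ _ _ ⟩
    (((s - t) ⊞ t) ⊞ indicator (suc i) j) ⊞ indicator (i ∸ k) j
      ≈⟨ +-congʳ (+-congʳ (//-rightDividesˡ t s)) ⟩
    (s ⊞ indicator (suc i) j) ⊞ indicator (i ∸ k) j
      ≈⟨ +-congʳ (superdiagonals-row k i j) ⟩
    indicator (suc i + k) j ⊞ indicator (i ∸ k) j ∎
    where
    i = toℕ i′
    j = toℕ j′
    s = superdiagonals k i j
    t = superdiagonals k j i

  sum-indicator₂ : ∀ {n} (x : Vector Carrier n) a b →
    sum (λ j → (indicator a (toℕ j) ⊞ indicator b (toℕ j)) ⊠ x j) ≈ prefixSum x a ⊞ prefixSum x b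
  sum-indicator₂ x a b = begin
    sum (λ j → (indicator a (toℕ j) ⊞ indicator b (toℕ j)) ⊠ x j)
      ≈⟨ sum-cong-≋ (λ j → distribʳ (x j) _ _) ⟩
    sum (λ j → indicator a (toℕ j) ⊠ x j ⊞ indicator b (toℕ j) ⊠ x j)
      ≈⟨ ∑-distrib-+ (λ j → indicator a (toℕ j) ⊠ x j) (λ j → indicator b (toℕ j) ⊠ x j) ⟩
    sum (λ j → indicator a (toℕ j) ⊠ x j) ⊞ sum (λ j → indicator b (toℕ j) ⊠ x j)
      ≈⟨ +-cong (sum-indicator x a) (sum-indicator x b) ⟩
    prefixSum x a ⊞ prefixSum x b ∎

  A-row : ∀ {n} k (x : Vector Carrier n) i →
    (A n k · x) i ⊞ (prefixSum x (suc (toℕ i)) ⊞ prefixSum x (toℕ i)) ≈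
    prefixSum x (suc (toℕ i) + k) ⊞ prefixSum x (toℕ i ∸ k)
  A-row {n} k x i = begin
    (A n k · x) i ⊞ (prefixSum x (suc (toℕ i)) ⊞ prefixSum x (toℕ i))
      ≈⟨ +-congˡ (sum-indicator₂ x (suc (toℕ i)) (toℕ i)) ⟨
    (A n k · x) i ⊞ sum (λ j → r j ⊠ x j)
      ≈⟨ ∑-distrib-+ (λ j → A n k i j ⊠ x j) (λ j → r j ⊠ x j) ⟨
    sum (λ j → A n k i j ⊠ x j ⊞ r j ⊠ x j)
      ≈⟨ sum-cong-≋ (λ j → trans (sym (distribʳ (x j) _ _)) (*-congʳ (A-entry k i j))) ⟩
    sum (λ j → (indicator (suc (toℕ i) + k) (toℕ j) ⊞ indicator (toℕ i ∸ k) (toℕ j)) ⊠ x j)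
      ≈⟨ sum-indicator₂ x (suc (toℕ i) + k) (toℕ i ∸ k) ⟩
    prefixSum x (suc (toℕ i) + k) ⊞ prefixSum x (toℕ i ∸ k) ∎
    where
    r : Fin n → Carrier
    r j = indicator (suc (toℕ i)) (toℕ j) ⊞ indicator (toℕ i) (toℕ j)

  RowEquation : ℕ → Sequence → ℕ → Set ℓ₁
  RowEquation k P i = P (suc i + k) ⊞ P (i ∸ k) ≈ P (suc i) ⊞ P i

  inKernel⇒rowEquation : ∀ {n k} {x : Vector Carrier n} → InKernel (A n k) x →
    ∀ {i} → i < n → RowEquation k (prefixSum x) i
  inKernel⇒rowEquation {k = k} {x} Ax≈0 i<n =
    ≡.subst (RowEquation k (prefixSum x)) (toℕ-fromℕ< i<n)
      (trans (sym (A-row k x i)) (trans (+-congʳ (Ax≈0 i)) (+-identityˡ _)))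
    where i = fromℕ< i<n

  rowEquation⇒inKernel : ∀ {n k} {x : Vector Carrier n} →
    (∀ {i} → i < n → RowEquation k (prefixSum x) i) → InKernel (A n k) x
  rowEquation⇒inKernel {k = k} {x} rows i =
    ∙-cancelʳ _ _ _ (trans (A-row k x i) (trans (rows (toℕ<n i)) (sym (+-identityˡ _))))

  -- The two ranges of rows of A(2k+3,k)

  size : ∀ k → suc k + (2 + k) ≡ 2 * k + 3
  size = solve-∀

  -- Up to row k the term `P (i ∸ k)` is `P 0` and drops out; `high` covers the remaining k + 2 rows
  -- i = k + 1 + m. Indices have the form `suc k + _` so that `splice` can be evaluated on them.
  record Rows (k : ℕ) (P : Sequence) : Set ℓ₁ where
    field
      low  : ∀ {i} → i ≤ k → P (suc k + i) ≈ P (suc i) ⊞ P i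
      high : ∀ {m} → m ≤ suc k →
             P (suc k + (suc m + k)) ⊞ P (suc m) ≈ P (suc k + suc m) ⊞ P (suc k + m)

  module _ (k : ℕ) (P : Sequence) (P0≈0 : P 0 ≈ 0#) where

    private
      lowLHS : ∀ {i} → i ≤ k → P (suc i + k) ⊞ P (i ∸ k) ≈ P (suc k + i)
      lowLHS {i} i≤k = begin
        P (suc i + k) ⊞ P (i ∸ k) ≈⟨ +-cong (at P (≡.cong suc (ℕₚ.+-comm i k))) (at P (ℕₚ.m≤n⇒m∸n≡0 i≤k)) ⟩
        P (suc k + i) ⊞ P 0       ≈⟨ +-congˡ P0≈0 ⟩
        P (suc k + i) ⊞ 0#        ≈⟨ +-identityʳ _ ⟩
        P (suc k + i)             ∎

      highLHS : ∀ m → P (suc (suc k + m) + k) ⊞ P (suc k + m ∸ k) ≈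
                      P (suc k + (suc m + k)) ⊞ P (suc m)
      highLHS m = +-cong (at P (index k m)) (at P (≡.trans (≡.cong (_∸ k) (≡.sym (ℕₚ.+-suc k m))) (ℕₚ.m+n∸m≡n k (suc m))))
        where
        index : ∀ k m → suc (suc k + m) + k ≡ suc k + (suc m + k)
        index = solve-∀

      highRHS : ∀ m → P (suc (suc k + m)) ⊞ P (suc k + m) ≈ P (suc k + suc m) ⊞ P (suc k + m)
      highRHS m = +-congʳ (at P (≡.sym (ℕₚ.+-suc (suc k) m)))

    rowEquation⇒Rows : (∀ {i} → i < 2 * k + 3 → RowEquation k P i) → Rows k P
    rowEquation⇒Rows rows = record
      { low  = λ {i} i≤k → trans (sym (lowLHS i≤k)) (rows (bound (ℕₚ.≤-trans i≤k (ℕₚ.m≤m+n k _))))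
      ; high = λ {m} m≤1+k → trans (sym (highLHS m))
                 (trans (rows (bound (s≤s⁻¹ (ℕₚ.+-monoʳ-< (suc k) (s≤s m≤1+k))))) (highRHS m))
      }
      where
      bound : ∀ {i} → i ≤ k + (2 + k) → i < 2 * k + 3
      bound {i} i≤ = ≡.subst (i <_) (size k) (s≤s i≤)

    Rows⇒rowEquation : Rows k P → ∀ {i} → i < 2 * k + 3 → RowEquation k P i
    Rows⇒rowEquation rows {i} i<n with i ℕₚ.≤? k
    ... | yes i≤k = trans (lowLHS i≤k) (Rows.low rows i≤k)
    ... | no  i≰k with ℕₚ.m≤n⇒∃[o]m+o≡n (ℕₚ.≰⇒> i≰k)
    ...   | m , ≡.refl = trans (highLHS m) (trans (Rows.high rows m≤1+k) (sym (highRHS m)))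
      where
      m≤1+k : m ≤ suc k
      m≤1+k = s≤s⁻¹ (ℕₚ.+-cancelˡ-< (suc k) m (2 + k) (≡.subst (suc k + m <_) (≡.sym (size k)) i<n))

  -- Words with constant sums of three consecutive letters

  total : Sequence → Carrier
  total g = g 0 ⊞ g 1 ⊞ g 2

  ConstantTripleSums : Sequence → Set ℓ₁
  ConstantTripleSums g = ∀ m → g m ⊞ g (1 + m) ⊞ g (2 + m) ≈ total g

  -- With constant triple sums, agreement at two places suffices for g to have period k.
  Closes : ℕ → Sequence → Set ℓ₁
  Closes k g = g k ≈ g 0 × g (suc k) ≈ g 1

  -- Subtracting neighbouring triple sums gives g (m + 3) = g m, so up to `_≈_` these are all the
  -- words with constant triple sums. The recursion makes the period 3 definitional.
  cycle : Carrier → Carrier → Carrier → Sequence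
  cycle a b c 0 = a
  cycle a b c 1 = b
  cycle a b c 2 = c
  cycle a b c (suc (suc (suc m))) = cycle a b c m

  cycle-constantTripleSums : ∀ a b c → ConstantTripleSums (cycle a b c)
  cycle-constantTripleSums a b c 0 = refl
  cycle-constantTripleSums a b c 1 = solve 3 (λ a b c → (b ⊕ c) ⊕ a ⊜ (a ⊕ b) ⊕ c) refl a b c
  cycle-constantTripleSums a b c 2 = solve 3 (λ a b c → (c ⊕ a) ⊕ b ⊜ (a ⊕ b) ⊕ c) refl a b c
  cycle-constantTripleSums a b c (suc (suc (suc m))) = cycle-constantTripleSums a b c m

  cycle-closes : ∀ a b c q → Closes (q * 3) (cycle a b c)
  cycle-closes a b c zero    = refl , refl
  cycle-closes a b c (suc q) = cycle-closes a b c q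

  -- The period 3 reduces k to its remainder. For remainder 1 or 2 the two equations of `Closes`
  -- link all three letters, as a nontrivial rotation of three letters has a single orbit.
  closes⇒constant : ∀ a b c k → ¬ (3 ∣ k) → Closes k (cycle a b c) → b ≈ a × c ≈ a
  closes⇒constant a b c 0 3∤k _ = contradiction (divides 0 ≡.refl) 3∤k
  closes⇒constant a b c 1 3∤k (b≈a , c≈b) = b≈a , trans c≈b b≈a
  closes⇒constant a b c 2 3∤k (c≈a , a≈b) = sym a≈b , c≈a
  closes⇒constant a b c (suc (suc (suc k))) 3∤k closes =
    closes⇒constant a b c k (λ 3∣k → 3∤k (∣m∣n⇒∣m+n ∣-refl 3∣k)) closes

  -- From words to kernel vectors

  -- The second sequence is reindexed from 0, and recursion replaces a decision on m < k, so that
  -- linearity can be proved branch by branch.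
  splice : ℕ → Sequence → Sequence → Sequence
  splice zero    u v m       = v m
  splice (suc k) u v zero    = u zero
  splice (suc k) u v (suc m) = splice k (λ i → u (suc i)) v m

  splice-< : ∀ {k m} u v → m < k → splice k u v m ≡ u m
  splice-< {suc k} {zero}  u v _         = ≡.refl
  splice-< {suc k} {suc m} u v (s≤s m<k) = splice-< (λ i → u (suc i)) v m<k

  splice-+ : ∀ k i u v → splice k u v (k + i) ≡ v i
  splice-+ zero    i u v = ≡.refl
  splice-+ (suc k) i u v = splice-+ k i (λ i → u (suc i)) v

  -- Puts P 0 = 0 in front of the letters P 1, P 2, ...
  delay : Sequence → Sequence
  delay g zero    = 0#
  delay g (suc m) = g m

  -- The prefix sums of the kernel vector belonging to the word g = P 1, P 2, ….
  potential : ℕ → Sequence → Sequence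
  potential k g = splice (suc k) (delay g) (splice (2 + k) (λ i → g i ⊞ delay g i) (λ _ → total g))

  -- The three ranges are 0 to k, where the letters are stored; k + 1 to 2k + 2, with the sums
  -- prescribed by the low rows and, at the last place, by row k + 1; and the constant range from 2k
  -- + 3 on.
  potential-low : ∀ k {m} g → m ≤ k → potential k g m ≈ delay g m
  potential-low k g m≤k = reflexive (splice-< _ _ (s≤s m≤k))

  potential-mid : ∀ k {i} g → i ≤ suc k → potential k g (suc k + i) ≈ g i ⊞ delay g i
  potential-mid k g i≤1+k = reflexive (≡.trans (splice-+ (suc k) _ (delay g) _) (splice-< _ _ (s≤s i≤1+k)))

  potential-high : ∀ k g i → potential k g (suc k + (2 + k + i)) ≈ total g
  potential-high k g i = reflexive (≡.trans (splice-+ (suc k) _ (delay g) _)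
    (splice-+ (2 + k) i (λ i → g i ⊞ delay g i) _))

  -- Reaches one place beyond `potential-low`: position k + 1 lies in the middle range with value g
  -- 0, which closing up turns into g k.
  potential-suc : ∀ k {i} g → Closes k g → i ≤ k → potential k g (suc i) ≈ g i
  potential-suc k {i} g (gk≈g0 , _) i≤k with ℕₚ.m≤n⇒m<n∨m≡n i≤k
  ... | inj₁ i<k    = potential-low k g i<k
  ... | inj₂ ≡.refl = begin
    potential k g (suc k)     ≈⟨ at (potential k g) (ℕₚ.+-identityʳ (suc k)) ⟨
    potential k g (suc k + 0) ≈⟨ potential-mid k g z≤n ⟩
    g 0 ⊞ 0#                  ≈⟨ +-identityʳ _ ⟩
    g 0                       ≈⟨ gk≈g0 ⟨
    g k                       ∎

  potential-Rows : ∀ k g → ConstantTripleSums g → Closes k g → Rows k (potential k g)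
  potential-Rows k g triples closes@(gk≈g0 , g1+k≈g1) = record { low = low ; high = high }
    where
    Q = potential k g

    low : ∀ {i} → i ≤ k → Q (suc k + i) ≈ Q (suc i) ⊞ Q i
    low {i} i≤k = begin
      Q (suc k + i)   ≈⟨ potential-mid k g (ℕₚ.m≤n⇒m≤1+n i≤k) ⟩
      g i ⊞ delay g i ≈⟨ +-cong (potential-suc k g closes i≤k) (potential-low k g i≤k) ⟨
      Q (suc i) ⊞ Q i ∎

    high : ∀ {m} → m ≤ suc k → Q (suc k + (suc m + k)) ⊞ Q (suc m) ≈ Q (suc k + suc m) ⊞ Q (suc k + m)
    -- Row k + 1 holds because g closes up at k and k + 1.
    high {zero} _ = begin
      Q (suc k + suc k) ⊞ Q 1           ≈⟨ +-cong (potential-mid k g ℕₚ.≤-refl) (potential-suc k g closes z≤n) ⟩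
      (g (suc k) ⊞ g k) ⊞ g 0           ≈⟨ +-congʳ (+-cong g1+k≈g1 gk≈g0) ⟩
      (g 1 ⊞ g 0) ⊞ g 0                 ≈⟨ +-congˡ (+-identityʳ _) ⟨
      (g 1 ⊞ g 0) ⊞ (g 0 ⊞ 0#)          ≈⟨ +-cong (potential-mid k g (s≤s z≤n)) (potential-mid k g z≤n) ⟨
      Q (suc k + 1) ⊞ Q (suc k + 0)     ∎
    high {suc m} (s≤s m≤k) with ℕₚ.m≤n⇒m<n∨m≡n m≤k
    -- Rows k + 2 to 2k + 1: the first term is past the end and equals the total, so the row is the
    -- triple sum at m with g (1 + m) added.
    ... | inj₁ m<k = begin
      Q (suc k + (2 + m + k)) ⊞ Q (2 + m)
        ≈⟨ +-cong (at Q (≡.cong (λ i → suc k + (2 + i)) (ℕₚ.+-comm m k))) (potential-suc k g closes m<k) ⟩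
      Q (suc k + (2 + k + m)) ⊞ g (1 + m)
        ≈⟨ +-congʳ (trans (potential-high k g m) (sym (triples m))) ⟩
      (g m ⊞ g (1 + m) ⊞ g (2 + m)) ⊞ g (1 + m)
        ≈⟨ solve 3 (λ a b c → ((a ⊕ b) ⊕ c) ⊕ b ⊜ (c ⊕ b) ⊕ (b ⊕ a)) refl _ _ _ ⟩
      (g (2 + m) ⊞ g (1 + m)) ⊞ (g (1 + m) ⊞ g m)
        ≈⟨ +-cong (potential-mid k g (s≤s m<k)) (potential-mid k g (s≤s m≤k)) ⟨
      Q (suc k + (2 + m)) ⊞ Q (suc k + (1 + m)) ∎
    -- Row 2k + 2: the total now occurs on both sides, leaving equality at positions k + 2 and 2k +
    -- 2, again by closing up.
    ... | inj₂ ≡.refl = begin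
      Q (suc k + (2 + k + k)) ⊞ Q (2 + k)
        ≈⟨ +-cong (potential-high k g k) (at Q (≡.sym (ℕₚ.+-comm (suc k) 1))) ⟩
      total g ⊞ Q (suc k + 1)
        ≈⟨ +-congˡ (potential-mid k g (s≤s z≤n)) ⟩
      total g ⊞ (g 1 ⊞ g 0)
        ≈⟨ +-congˡ (+-cong g1+k≈g1 gk≈g0) ⟨
      total g ⊞ (g (suc k) ⊞ g k)
        ≈⟨ +-cong (potential-high k g 0) (potential-mid k g ℕₚ.≤-refl) ⟨
      Q (suc k + (2 + k + 0)) ⊞ Q (suc k + suc k)
        ≈⟨ +-congʳ (at Q (≡.cong (suc k +_) (ℕₚ.+-identityʳ (2 + k)))) ⟩
      Q (suc k + (2 + k)) ⊞ Q (suc k + suc k) ∎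

  kernelVector : ∀ k → Sequence → Vector Carrier (2 * k + 3)
  kernelVector k g = difference (potential k g)

  -- Up to 2k + 3 this is telescoping; past it both sides stay constant.
  prefixSum-kernelVector : ∀ k g b → prefixSum (kernelVector k g) b ≈ potential k g b
  prefixSum-kernelVector k g b with b ℕₚ.≤? 2 * k + 3
  -- `potential k g 0` computes to `0#`, which absorbs the extra summand of `prefixSum-difference`.
  ... | yes b≤n = trans (sym (+-identityʳ _)) (prefixSum-difference (potential k g) b≤n)
  ... | no  b≰n with ℕₚ.m≤n⇒∃[o]m+o≡n (ℕₚ.≰⇒≥ b≰n)
  ...   | i , ≡.refl = begin
    prefixSum (kernelVector k g) (2 * k + 3 + i) ≈⟨ prefixSum-saturated (kernelVector k g) i ⟩
    prefixSum (kernelVector k g) (2 * k + 3)     ≈⟨ +-identityʳ _ ⟨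
    prefixSum (kernelVector k g) (2 * k + 3) ⊞ 0# ≈⟨ prefixSum-difference {2 * k + 3} (potential k g) ℕₚ.≤-refl ⟩
    Q (2 * k + 3)                                ≈⟨ at Q (index₀ k) ⟩
    Q (suc k + (2 + k + 0))                      ≈⟨ potential-high k g 0 ⟩
    total g                                      ≈⟨ potential-high k g i ⟨
    Q (suc k + (2 + k + i))                      ≈⟨ at Q (index k i) ⟨
    Q (2 * k + 3 + i)                            ∎
    where
    Q = potential k g
    index : ∀ k i → 2 * k + 3 + i ≡ suc k + (2 + k + i)
    index = solve-∀
    index₀ : ∀ k → 2 * k + 3 ≡ suc k + (2 + k + 0)
    index₀ = solve-∀

  kernelVector-inKernel : ∀ k g → ConstantTripleSums g → Closes k g →
    InKernel (A (2 * k + 3) k) (kernelVector k g)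
  kernelVector-inKernel k g triples closes = rowEquation⇒inKernel {k = k} λ {i} i<n →
    trans (+-cong (P≈Q (suc i + k)) (P≈Q (i ∸ k)))
      (trans (Rows⇒rowEquation k (potential k g) refl (potential-Rows k g triples closes) i<n)
        (sym (+-cong (P≈Q (suc i)) (P≈Q i))))
    where P≈Q = prefixSum-kernelVector k g

  -- The first k letters are prefix sums of the vector, so they vanish with it.
  kernelVector-injective : ∀ k g → (∀ j → kernelVector k g j ≈ 0#) → ∀ {m} → m < k → g m ≈ 0#
  kernelVector-injective k g v≈0 {m} m<k = begin
    g m                                  ≈⟨ potential-low k g m<k ⟨
    potential k g (suc m)                ≈⟨ prefixSum-kernelVector k g (suc m) ⟨
    prefixSum (kernelVector k g) (suc m) ≈⟨ prefixSum-zero (kernelVector k g) v≈0 (suc m) ⟩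
    0#                                   ∎

  -- From kernel vectors to words

  -- With k = k₀ + 1, the letter P k has index k₀ in the word, and row 1 is among the low rows.
  module FromKernel (k₀ : ℕ) (x : Vector Carrier (2 * suc k₀ + 3))
    (Ax≈0 : InKernel (A (2 * suc k₀ + 3) (suc k₀)) x) where

    private
      k = suc k₀
      P = prefixSum x
      T = P (2 * k + 3)

    open Rows (rowEquation⇒Rows k P refl (inKernel⇒rowEquation {k = k} Ax≈0))

    private
      P-high : ∀ i → P (suc k + (2 + k + i)) ≈ T
      P-high i = trans (at P (index k i)) (prefixSum-saturated x i)
        where
        index : ∀ k i → suc k + (2 + k + i) ≡ 2 * k + 3 + i
        index = solve-∀

    -- The third letter is what T leaves over, not `P 3`: for k = 1 position 3 is in the middle
    -- range, where `P 3` is P 2 + P 1.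
    word : Sequence
    word = cycle (P 1) (P 2) (T - (P 1 ⊞ P 2))

    word-total : total word ≈ T
    word-total = trans (+-comm _ _) (//-rightDividesˡ (P 1 ⊞ P 2) T)

    word-triple : ∀ m → word m ⊞ word (1 + m) ⊞ word (2 + m) ≈ T
    word-triple m = trans (cycle-constantTripleSums _ _ _ m) word-total

    P-first : P (suc k) ≈ P 1
    P-first = begin
      P (suc k)     ≈⟨ at P (ℕₚ.+-identityʳ (suc k)) ⟨
      P (suc k + 0) ≈⟨ low z≤n ⟩
      P 1 ⊞ 0#      ≈⟨ +-identityʳ _ ⟩
      P 1           ∎

    -- Row k + 1, with its right side evaluated by rows 1 and 0.
    P-last : P (suc k + suc k) ≈ P 2 ⊞ P 1
    P-last = ∙-cancelʳ (P 1) _ _ (begin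
      P (suc k + suc k) ⊞ P 1       ≈⟨ high z≤n ⟩
      P (suc k + 1) ⊞ P (suc k + 0) ≈⟨ +-cong (low (s≤s z≤n)) (trans (at P (ℕₚ.+-identityʳ (suc k))) P-first) ⟩
      (P 2 ⊞ P 1) ⊞ P 1             ∎)

    P-high-row : ∀ {m} → m ≤ k → T ⊞ P (2 + m) ≈ P (suc k + (2 + m)) ⊞ P (suc k + (1 + m))
    P-high-row {m} m≤k = begin
      T ⊞ P (2 + m)                        ≈⟨ +-congʳ (P-high m) ⟨
      P (suc k + (2 + k + m)) ⊞ P (2 + m)  ≈⟨ +-congʳ (at P (≡.cong (λ i → suc k + (2 + i)) (ℕₚ.+-comm k m))) ⟩
      P (suc k + (2 + m + k)) ⊞ P (2 + m)  ≈⟨ high (s≤s m≤k) ⟩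
      P (suc k + (2 + m)) ⊞ P (suc k + (1 + m)) ∎

    -- Low rows 2 + m and 1 + m expand the right side of `P-high-row`, and one `P (2 + m)` cancels.
    P-triple : ∀ {m} → 2 + m ≤ k → P (1 + m) ⊞ P (2 + m) ⊞ P (3 + m) ≈ T
    P-triple {m} 2+m≤k = ∙-cancelʳ (P (2 + m)) _ _ (begin
      (P (1 + m) ⊞ P (2 + m) ⊞ P (3 + m)) ⊞ P (2 + m)
        ≈⟨ solve 3 (λ a b c → ((a ⊕ b) ⊕ c) ⊕ b ⊜ (c ⊕ b) ⊕ (b ⊕ a)) refl _ _ _ ⟩
      (P (3 + m) ⊞ P (2 + m)) ⊞ (P (2 + m) ⊞ P (1 + m))
        ≈⟨ +-cong (low 2+m≤k) (low 1+m≤k) ⟨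
      P (suc k + (2 + m)) ⊞ P (suc k + (1 + m))
        ≈⟨ P-high-row (ℕₚ.<⇒≤ 1+m≤k) ⟨
      T ⊞ P (2 + m) ∎)
      where
      1+m≤k : 1 + m ≤ k
      1+m≤k = ℕₚ.<⇒≤ 2+m≤k

    -- The triple that wraps around, from row 2k + 1. Its term at 2k + 2 is out of reach of the low
    -- rows and comes from `P-last`.
    P-closing : P k ⊞ P 1 ⊞ P 2 ≈ T
    P-closing = ∙-cancelʳ (P (suc k)) _ _ (begin
      (P k ⊞ P 1 ⊞ P 2) ⊞ P (suc k)
        ≈⟨ solve 4 (λ a b c d → ((a ⊕ b) ⊕ c) ⊕ d ⊜ (c ⊕ b) ⊕ (d ⊕ a)) refl _ _ _ _ ⟩
      (P 2 ⊞ P 1) ⊞ (P (suc k) ⊞ P k)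
        ≈⟨ +-cong P-last (low ℕₚ.≤-refl) ⟨
      P (suc k + suc k) ⊞ P (suc k + k)
        ≈⟨ P-high-row (ℕₚ.n≤1+n k₀) ⟨
      T ⊞ P (suc k) ∎)

    -- Both sides start with the same two letters and have triple sums T, so each next letter is
    -- determined. `P-triple` reaches as far as P (k + 1).
    word≈P : ∀ m → m ≤ k → word m ≈ P (suc m)
    word≈P 0 _ = refl
    word≈P 1 _ = refl
    word≈P (suc (suc m)) 2+m≤k = ∙-cancelˡ (P (1 + m) ⊞ P (2 + m)) _ _ (begin
      P (1 + m) ⊞ P (2 + m) ⊞ word (2 + m)
        ≈⟨ +-congʳ (+-cong (word≈P m (ℕₚ.<⇒≤ (ℕₚ.<⇒≤ 2+m≤k))) (word≈P (suc m) (ℕₚ.<⇒≤ 2+m≤k))) ⟨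
      word m ⊞ word (1 + m) ⊞ word (2 + m)
        ≈⟨ word-triple m ⟩
      T
        ≈⟨ P-triple 2+m≤k ⟨
      P (1 + m) ⊞ P (2 + m) ⊞ P (3 + m) ∎)

    -- Place k is `P-first`; for place k + 1 the triple of the word at k₀ is compared with
    -- `P-closing`.
    word-closes : Closes k word
    word-closes = word-k , ∙-cancelˡ (P k ⊞ P 1) _ _ (begin
      P k ⊞ P 1 ⊞ word (suc k)          ≈⟨ +-congʳ (+-cong (word≈P k₀ (ℕₚ.n≤1+n k₀)) word-k) ⟨
      word k₀ ⊞ word k ⊞ word (suc k)   ≈⟨ word-triple k₀ ⟩
      T                                 ≈⟨ P-closing ⟨
      P k ⊞ P 1 ⊞ P 2                   ∎)
      where
      word-k : word k ≈ P 1
      word-k = trans (word≈P k ℕₚ.≤-refl) P-first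

    delay-word≈P : ∀ {m} → m ≤ suc k → delay word m ≈ P m
    delay-word≈P {zero}  _         = refl
    delay-word≈P {suc m} (s≤s m≤k) = word≈P m m≤k

    potential-mid≈P : ∀ {i} → i ≤ suc k → word i ⊞ delay word i ≈ P (suc k + i)
    potential-mid≈P {i} i≤1+k with ℕₚ.m≤n⇒m<n∨m≡n i≤1+k
    ... | inj₁ (s≤s i≤k) = trans (+-cong (word≈P i i≤k) (delay-word≈P i≤1+k)) (sym (low i≤k))
    -- Position 2k + 2 is not given by a low row, so `P-last` takes over after closing up.
    ... | inj₂ ≡.refl    = trans (+-cong (proj₂ word-closes) (proj₁ word-closes)) (sym P-last)

    potential≈P : ∀ m → potential k word m ≈ P m
    potential≈P m with m ℕₚ.≤? k
    ... | yes m≤k = trans (potential-low k word m≤k) (delay-word≈P (ℕₚ.m≤n⇒m≤1+n m≤k))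
    ... | no  m≰k with ℕₚ.m≤n⇒∃[o]m+o≡n (ℕₚ.≰⇒> m≰k)
    ...   | i , ≡.refl with i ℕₚ.≤? suc k
    ...     | yes i≤1+k = trans (potential-mid k word i≤1+k) (potential-mid≈P i≤1+k)
    ...     | no  i≰1+k with ℕₚ.m≤n⇒∃[o]m+o≡n (ℕₚ.≰⇒> i≰1+k)
    ...       | l , ≡.refl = trans (potential-high k word l) (trans word-total (sym (P-high l)))

    kernelVector-word : ∀ j → kernelVector k word j ≈ x j
    kernelVector-word j =
      trans (+-cong (potential≈P (suc (toℕ j))) (-‿cong (potential≈P (toℕ j)))) (difference-prefixSum x j)

  -- Common to both cases: divisibility by 3 only decides what `Closes` demands of the three
  -- letters.
  kernelVector-surjective : ∀ {k} → 1 ≤ k → ∀ x → InKernel (A (2 * k + 3) k) x →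
    ∃[ a ] ∃[ b ] ∃[ c ] (Closes k (cycle a b c) × ∀ j → kernelVector k (cycle a b c) j ≈ x j)
  kernelVector-surjective {suc k₀} _ x Ax≈0 = _ , _ , _ , word-closes , kernelVector-word
    where open FromKernel k₀ x Ax≈0

  -- Linearity of g ↦ kernelVector k g

  module Combination {d : ℕ} (a : Vector Carrier d) where

    infix 4 _↝_

    -- A relation rather than an equation between functions, so that each construction on words gets
    -- one closure rule and the rules compose.
    _↝_ : Vector Carrier d → Carrier → Set ℓ₁
    u ↝ v = sum (λ i → a i ⊠ u i) ≈ v

    ↝-zero : (λ _ → 0#) ↝ 0#
    ↝-zero = trans (sum-cong-≋ (λ i → zeroʳ (a i))) (sum-replicate-zero d)

    ↝-+ : ∀ {u v s t} → u ↝ s → v ↝ t → (λ i → u i ⊞ v i) ↝ s ⊞ t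
    ↝-+ {u} {v} {s} {t} u↝s v↝t = begin
      sum (λ i → a i ⊠ (u i ⊞ v i))                   ≈⟨ sum-cong-≋ (λ i → distribˡ (a i) _ _) ⟩
      sum (λ i → a i ⊠ u i ⊞ a i ⊠ v i)               ≈⟨ ∑-distrib-+ (λ i → a i ⊠ u i) (λ i → a i ⊠ v i) ⟩
      sum (λ i → a i ⊠ u i) ⊞ sum (λ i → a i ⊠ v i)   ≈⟨ +-cong u↝s v↝t ⟩
      s ⊞ t                                           ∎

    ↝-minus : ∀ {u v s t} → u ↝ s → v ↝ t → (λ i → u i - v i) ↝ s - t
    ↝-minus {u} {v} {s} {t} u↝s v↝t = ∙-cancelʳ t _ _ (begin
      sum (λ i → a i ⊠ (u i - v i)) ⊞ t               ≈⟨ ↝-+ refl v↝t ⟨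
      sum (λ i → a i ⊠ ((u i - v i) ⊞ v i))           ≈⟨ sum-cong-≋ (λ i → *-congˡ (//-rightDividesˡ (v i) (u i))) ⟩
      sum (λ i → a i ⊠ u i)                           ≈⟨ u↝s ⟩
      s                                               ≈⟨ //-rightDividesˡ t s ⟨
      (s - t) ⊞ t                                     ∎)

    -- The branch taken depends only on k and m, so it is the same for every i.
    ↝-splice : ∀ {u u′ : Fin d → Sequence} {v v′} k →
      (∀ m → (λ i → u i m) ↝ v m) → (∀ m → (λ i → u′ i m) ↝ v′ m) →
      ∀ m → (λ i → splice k (u i) (u′ i) m) ↝ splice k v v′ m
    ↝-splice zero    u↝v u′↝v′ m       = u′↝v′ m
    ↝-splice (suc k) u↝v u′↝v′ zero    = u↝v zero
    ↝-splice (suc k) u↝v u′↝v′ (suc m) = ↝-splice k (λ m → u↝v (suc m)) u′↝v′ m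

    ↝-kernelVector : ∀ k (g : Fin d → Sequence) h → (∀ m → (λ i → g i m) ↝ h m) →
      ∀ j → (λ i → kernelVector k (g i) j) ↝ kernelVector k h j
    ↝-kernelVector k g h g↝h j = ↝-minus (↝-potential (suc (toℕ j))) (↝-potential (toℕ j))
      where
      ↝-delay : ∀ m → (λ i → delay (g i) m) ↝ delay h m
      ↝-delay zero    = ↝-zero
      ↝-delay (suc m) = g↝h m

      ↝-potential : ∀ m → (λ i → potential k (g i) m) ↝ potential k h m
      ↝-potential = ↝-splice (suc k) ↝-delay
        (↝-splice (2 + k) (λ m → ↝-+ (g↝h m) (↝-delay m)) (λ _ → ↝-+ (↝-+ (g↝h 0) (g↝h 1)) (g↝h 2)))

  open Combination using (_↝_; ↝-kernelVector)

  -- Bases of the kernel in the two cases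

  unitWord : Fin 3 → Sequence
  unitWord fzero               = cycle 1# 0# 0#
  unitWord (fsuc fzero)        = cycle 0# 1# 0#
  unitWord (fsuc (fsuc fzero)) = cycle 0# 0# 1#

  cycleOf : Vector Carrier 3 → Sequence
  cycleOf a = cycle (a fzero) (a (fsuc fzero)) (a (fsuc (fsuc fzero)))

  unitWord-combination : ∀ a m → _↝_ a (λ i → unitWord i m) (cycleOf a m)
  unitWord-combination a 0 = begin
    _ ≈⟨ +-cong (*-identityʳ _) (+-cong (zeroʳ _) (+-congʳ (zeroʳ _))) ⟩
    _ ≈⟨ solve 1 (λ a → a ⊕ (id ⊕ (id ⊕ id)) ⊜ a) refl _ ⟩
    _ ∎
  unitWord-combination a 1 = begin
    _ ≈⟨ +-cong (zeroʳ _) (+-cong (*-identityʳ _) (+-congʳ (zeroʳ _))) ⟩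
    _ ≈⟨ solve 1 (λ a → id ⊕ (a ⊕ (id ⊕ id)) ⊜ a) refl _ ⟩
    _ ∎
  unitWord-combination a 2 = begin
    _ ≈⟨ +-cong (zeroʳ _) (+-cong (zeroʳ _) (+-congʳ (*-identityʳ _))) ⟩
    _ ≈⟨ solve 1 (λ a → id ⊕ (id ⊕ (a ⊕ id)) ⊜ a) refl _ ⟩
    _ ∎
  unitWord-combination a (suc (suc (suc m))) = unitWord-combination a m

  nullity-3∣k : ∀ {k} → 1 ≤ k → 3 ∣ k → HasNullity (A (2 * k + 3) k) 3
  nullity-3∣k {k} 1≤k 3∣k@(divides q k≡q*3) = (λ i → kernelVector k (unitWord i)) , record
    { inKernel    = inKernel
    ; independent = λ a comb≈0 → independent a λ j →
        trans (sym (↝-kernelVector a k unitWord (cycleOf a) (unitWord-combination a) j)) (comb≈0 j)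
    ; spanning    = spanning
    }
    where
    -- Makes all three letters belong to the first k, which the vector determines.
    3≤k : 3 ≤ k
    3≤k = ∣⇒≤ ⦃ >-nonZero 1≤k ⦄ 3∣k

    closes : ∀ a b c → Closes k (cycle a b c)
    closes a b c = ≡.subst (λ k → Closes k (cycle a b c)) (≡.sym k≡q*3) (cycle-closes a b c q)

    inKernel : ∀ i → InKernel (A (2 * k + 3) k) (kernelVector k (unitWord i))
    inKernel fzero = kernelVector-inKernel k _ (cycle-constantTripleSums 1# 0# 0#) (closes 1# 0# 0#)
    inKernel (fsuc fzero) = kernelVector-inKernel k _ (cycle-constantTripleSums 0# 1# 0#) (closes 0# 1# 0#)
    inKernel (fsuc (fsuc fzero)) = kernelVector-inKernel k _ (cycle-constantTripleSums 0# 0# 1#) (closes 0# 0# 1#)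

    independent : ∀ a → (∀ j → kernelVector k (cycleOf a) j ≈ 0#) → ∀ i → a i ≈ 0#
    independent a v≈0 fzero               = kernelVector-injective k (cycleOf a) v≈0 1≤k
    independent a v≈0 (fsuc fzero)        = kernelVector-injective k (cycleOf a) v≈0 (ℕₚ.<⇒≤ 3≤k)
    independent a v≈0 (fsuc (fsuc fzero)) = kernelVector-injective k (cycleOf a) v≈0 3≤k

    spanning : ∀ x → InKernel (A (2 * k + 3) k) x →
      ∃[ a ] (∀ j → linearCombination a (λ i → kernelVector k (unitWord i)) j ≈ x j)
    spanning x Ax≈0 with kernelVector-surjective 1≤k x Ax≈0
    ... | a₀ , a₁ , a₂ , _ , v≈x = a , λ j → trans (↝-kernelVector a k unitWord (cycleOf a) (unitWord-combination a) j) (v≈x j)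
      where
      a : Vector Carrier 3
      a fzero               = a₀
      a (fsuc fzero)        = a₁
      a (fsuc (fsuc fzero)) = a₂

  -- A kernel vector comes from a word of period 3 that closes up at k; by `closes⇒constant` it is a
  -- multiple of 1, 1, 1, ..., with its first letter as the coefficient.
  nullity-3∤k : ∀ {k} → 1 ≤ k → ¬ (3 ∣ k) → HasNullity (A (2 * k + 3) k) 1
  nullity-3∤k {k} 1≤k 3∤k = (λ _ → kernelVector k (λ _ → 1#)) , record
    { inKernel    = λ _ → kernelVector-inKernel k (λ _ → 1#) (λ _ → refl) (refl , refl)
    ; independent = λ a comb≈0 → λ { fzero → kernelVector-injective k (λ _ → a fzero)
        (λ j → trans (sym (↝-kernelVector a k (λ _ _ → 1#) (λ _ → a fzero) (λ _ → combination a) j)) (comb≈0 j)) 1≤k }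
    ; spanning    = spanning
    }
    where
    combination : ∀ a → _↝_ a (λ _ → 1#) (a fzero)
    combination a = trans (+-identityʳ _) (*-identityʳ _)

    spanning : ∀ x → InKernel (A (2 * k + 3) k) x →
      ∃[ a ] (∀ j → linearCombination a (λ _ → kernelVector k (λ _ → 1#)) j ≈ x j)
    spanning x Ax≈0 with kernelVector-surjective 1≤k x Ax≈0
    ... | a₀ , a₁ , a₂ , closes , v≈x =
      (λ _ → a₀) , λ j → trans (↝-kernelVector (λ _ → a₀) k (λ (_ : Fin 1) _ → 1#) (cycle a₀ a₁ a₂) constant j) (v≈x j)
      where
      a₁≈a₀ : a₁ ≈ a₀
      a₁≈a₀ = proj₁ (closes⇒constant a₀ a₁ a₂ k 3∤k closes)

      a₂≈a₀ : a₂ ≈ a₀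
      a₂≈a₀ = proj₂ (closes⇒constant a₀ a₁ a₂ k 3∤k closes)

      constant : ∀ m → _↝_ (λ _ → a₀) (λ (_ : Fin 1) → 1#) (cycle a₀ a₁ a₂ m)
      constant 0 = combination (λ _ → a₀)
      constant 1 = trans (combination (λ _ → a₀)) (sym a₁≈a₀)
      constant 2 = trans (combination (λ _ → a₀)) (sym a₂≈a₀)
      constant (suc (suc (suc m))) = constant m

theorem8p3 : ∀ {c ℓ₁ ℓ₂ : Level} (F : HeytingField c ℓ₁ ℓ₂) →
    let open LinearAlgebra F in
    CharacteristicZero →
    ∀ (k : ℕ) → 1 ≤ k →
    (3 ∣ k → HasNullity (A (2 * k + 3) k) 3) ×
    (¬ (3 ∣ k) → HasNullity (A (2 * k + 3) k) 1)
theorem8p3 F _ k 1≤k = Kernel.nullity-3∣k F 1≤k , Kernel.nullity-3∤k F 1≤k
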